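{- Let $r \geq 6$ and let $G$ be a graph on $n \geq r$ vertices. If $G$ equipped with a rainbow edge-coloring (all edges receiving distinct colors) is $C_r$-rainbow saturated, then $e(G) \geq \frac{4}{3}n$.
   Context: All graphs are finite, simple and undirected. An edge-coloring of a graph $G$ is a function $\mathcal{C}:E(G)\to\mathbb{N}$; a (sub)graph is rainbow if all its edges have distinct colors. An edge-colored graph $G$ is $C_r$-rainbow saturated if it contains no rainbow copy of the cycle $C_r$ on $r$ vertices but adding any nonedge of $G$ with any color on it creates a rainbow copy of $C_r$. -}

module Defs where

open import Data.Nat using (ℕ; zero; suc; _<ᵇ_)

open import Data.Nat.DivMod using (_%_; m%n<n)
open import Data.Fin using (Fin; toℕ; fromℕ<; _≟_)
open import Data.Bool using (Bool; true; false; if_then_else_; _∧_; _∨_)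
open import Data.List using (List; map; allFin)
open import Data.Nat.ListAction using (sum)
open import Data.Product using (Σ; _×_; _,_)
open import Data.Sum using (_⊎_)
open import Data.Empty using (⊥)
open import Relation.Nullary using (¬_)
open import Relation.Nullary.Decidable using (⌊_⌋)
open import Relation.Binary.PropositionalEquality using (_≡_)
open import Function.Definitions using (Injective)

record Graph (n : ℕ) : Set where
  field
    adj     : Fin n → Fin n → Bool
    symm    : ∀ x y → adj x y ≡ adj y x
    irrefl  : ∀ x → adj x x ≡ false
open Graph public

-- An edge-coloring: colors in ℕ, assigned to (unordered) pairs; only the
-- values on edges matter.  We represent it as a function on ordered pairs
-- and require symmetry on edges (so it is a function on E(G)).
Coloring : ℕ → Set
Coloring n = Fin n → Fin n → ℕ

IsEdgeColoring : ∀ {n} → Graph n → Coloring n → Set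
IsEdgeColoring G c = ∀ x y → adj G x y ≡ true → c x y ≡ c y x

IsRainbowColoring : ∀ {n} → Graph n → Coloring n → Set
IsRainbowColoring G c =
  ∀ x y x' y' → adj G x y ≡ true → adj G x' y' ≡ true → c x y ≡ c x' y' →
  (x ≡ x' × y ≡ y') ⊎ (x ≡ y' × y ≡ x')

next : ∀ {m} → Fin (suc m) → Fin (suc m)
next {m} i = fromℕ< (m%n<n (suc (toℕ i)) (suc m))

RainbowCycle′ : ∀ {n} (m : ℕ) → (Fin n → Fin n → Bool) → Coloring n → Set
RainbowCycle′ {n} m a c =
  Σ (Fin (suc m) → Fin n) λ v →
    Injective _≡_ _≡_ v ×
    (∀ i → a (v i) (v (next i)) ≡ true) ×
    (∀ i j → c (v i) (v (next i)) ≡ c (v j) (v (next j)) → i ≡ j)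

HasRainbowCycle : ∀ {n} (r : ℕ) → (Fin n → Fin n → Bool) → Coloring n → Set
HasRainbowCycle zero    a c = ⊥
HasRainbowCycle (suc m) a c = RainbowCycle′ m a c

isPair : ∀ {n} → Fin n → Fin n → Fin n → Fin n → Bool
isPair u v x y = (⌊ x ≟ u ⌋ ∧ ⌊ y ≟ v ⌋) ∨ (⌊ x ≟ v ⌋ ∧ ⌊ y ≟ u ⌋)

addEdgeAdj : ∀ {n} → Graph n → Fin n → Fin n → Fin n → Fin n → Bool
addEdgeAdj G u v x y = adj G x y ∨ isPair u v x y

addEdgeCol : ∀ {n} → Coloring n → Fin n → Fin n → ℕ → Coloring n
addEdgeCol c u v k x y = if isPair u v x y then k else c x y

RainbowSaturated : ∀ {n} (r : ℕ) → Graph n → Coloring n → Set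
RainbowSaturated r G c =
  ¬ HasRainbowCycle r (adj G) c ×
  (∀ u v → ¬ u ≡ v → adj G u v ≡ false → (k : ℕ) →
     HasRainbowCycle r (addEdgeAdj G u v) (addEdgeCol c u v k))

edgeCount : ∀ {n} → Graph n → ℕ
edgeCount {n} G =
  sum (map (λ x → sum (map (λ y →
    if (toℕ x <ᵇ toℕ y) ∧ adj G x y then 1 else 0) (allFin n))) (allFin n))

{-# OPTIONS --safe #-}
module Submission where

-- In a saturated G, two nonadjacent vertices u, v are joined, for every edge e,
-- by a path on r vertices that avoids e. Choosing e next to an end of the path
-- gives: all degrees are at least 2; two adjacent vertices of degree 2 have
-- their other neighbour x in common, deg x ≥ 5, and x is the apex of no other
-- such triangle; a vertex of degree 3 has at most one neighbour of degree 2.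
-- The bound follows by discharging: a vertex of degree 2 takes 1 from each
-- neighbour, or 2 from the apex if it lies in such a triangle; afterwards every
-- vertex x, starting with 3 deg x, keeps at least 8, so 6 e(G) ≥ 8 n.

open import Defs
open import Data.Nat using (ℕ; zero; suc; _+_; _∸_; _*_; _≤_; _<_; z≤n; s≤s; z<s; _<ᵇ_; _<?_; _≤?_)
open import Data.Nat.Properties as ℕ
  using (≤-refl; ≤-trans; <⇒≤; ≤-antisym; m≤m+n; n≤1+n; <ᵇ⇒<; +-mono-≤; +-suc; +-comm; +-identityʳ;
         m∸n≤m; ∸-cancelˡ-≡; +-∸-assoc; n∸n≡0; m+[n∸m]≡n)
open import Data.Nat.DivMod using (_%_; m%n<n; m<n⇒m%n≡m; m%n%n≡m%n; [m+n]%n≡m%n; n%n≡0; %-distribˡ-+)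
open import Data.Nat.ListAction using (sum)
open import Data.Nat.ListAction.Properties using (sum-↭)
open import Data.Nat.Tactic.RingSolver using (solve-∀)
open import Data.Fin using (Fin; toℕ; fromℕ<; _≟_)
open import Data.Fin.Properties
  using (toℕ-injective; toℕ-fromℕ<; toℕ<n; toℕ≤pred[n]; any?; injective⇒≤; ¬∀⟶∃¬)
open import Data.Bool using (Bool; true; false; if_then_else_; _∧_; _∨_; T)
open import Data.Bool.Properties as 𝔹 using (∨-identityʳ; ¬-not)
open import Data.List using (List; []; _∷_; length; map; filter; allFin)
open import Data.List.Properties using (length-tabulate)
open import Data.List.Membership.Propositional using (_∈_; _∉_; find)
open import Data.List.Membership.Propositional.Properties using (∈-filter⁺; ∈-filter⁻; ∈-allFin; ∈-∃++)
open import Data.List.Membership.Setoid.Properties using (index-injective)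
import Data.List.Membership.DecPropositional as DecMembership
open import Data.List.Relation.Unary.Any using (here; there)
open import Data.List.Relation.Unary.All as All using (All; []; _∷_; all?)
open import Data.List.Relation.Unary.All.Properties using (¬All⇒Any¬)
open import Data.List.Relation.Unary.AllPairs using (_∷_)
open import Data.List.Relation.Unary.Unique.Propositional using (Unique)
import Data.List.Relation.Unary.Unique.Propositional.Properties as Unique
open import Data.List.Relation.Binary.Permutation.Propositional
  using (_↭_; ↭-refl; ↭-sym; ↭-trans; ↭-reflexive; ↭-swap; ↭-prep; ↭⇒↭ₛ)
open import Data.List.Relation.Binary.Permutation.Propositional.Properties
  using (∈-resp-↭; All-resp-↭; ↭-length; shift; map⁺)
open import Data.List.Relation.Binary.Permutation.Setoid.Properties using (Unique-resp-↭)
open import Data.Product using (∃; ∃₂; _×_; _,_; proj₁; proj₂)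
open import Data.Sum using (_⊎_; inj₁; inj₂)
open import Data.Empty using (⊥; ⊥-elim)
open import Function using (_∘_)
open import Function.Definitions using (Injective)
open import Relation.Nullary using (¬_; yes; no; contradiction)
open import Relation.Binary.PropositionalEquality

-- Arithmetic of cyclic indices.

module _ {m : ℕ} where

  -- Reading naturals modulo `suc m` lets a cycle be traversed from any starting index by ordinary
  -- addition instead of iterating `next`.
  wrap : ℕ → Fin (suc m)
  wrap s = fromℕ< (m%n<n s (suc m))

  toℕ-wrap : ∀ s → toℕ (wrap s) ≡ s % suc m
  toℕ-wrap s = toℕ-fromℕ< (m%n<n s (suc m))

  %-+-cong : ∀ a b t → a % suc m ≡ b % suc m → (a + t) % suc m ≡ (b + t) % suc m
  %-+-cong a b t eq = begin
    (a + t) % suc m                   ≡⟨ %-distribˡ-+ a t (suc m) ⟩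
    (a % suc m + t % suc m) % suc m   ≡⟨ cong (λ z → (z + t % suc m) % suc m) eq ⟩
    (b % suc m + t % suc m) % suc m   ≡⟨ %-distribˡ-+ b t (suc m) ⟨
    (b + t) % suc m                   ∎
    where open ≡-Reasoning

  next-wrap : ∀ s → next (wrap s) ≡ wrap (suc s)
  next-wrap s = toℕ-injective (begin
    toℕ (next (wrap s))         ≡⟨ toℕ-fromℕ< _ ⟩
    suc (toℕ (wrap s)) % suc m  ≡⟨ cong (λ z → suc z % suc m) (toℕ-wrap s) ⟩
    suc (s % suc m) % suc m     ≡⟨ cong (_% suc m) (+-comm 1 (s % suc m)) ⟩
    (s % suc m + 1) % suc m     ≡⟨ %-+-cong (s % suc m) s 1 (m%n%n≡m%n s (suc m)) ⟩
    (s + 1) % suc m             ≡⟨ cong (_% suc m) (+-comm s 1) ⟩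
    suc s % suc m               ≡⟨ toℕ-wrap (suc s) ⟨
    toℕ (wrap (suc s))          ∎)
    where open ≡-Reasoning

  wrap-toℕ : ∀ i → wrap (toℕ i) ≡ i
  wrap-toℕ i = toℕ-injective (trans (toℕ-wrap (toℕ i)) (m<n⇒m%n≡m (toℕ<n i)))

  wrap-period : ∀ s → wrap (s + suc m) ≡ wrap s
  wrap-period s = toℕ-injective
    (trans (toℕ-wrap (s + suc m)) (trans ([m+n]%n≡m%n s (suc m)) (sym (toℕ-wrap s))))

  wrap-injective : ∀ {s t} → s < suc m → t < suc m → wrap s ≡ wrap t → s ≡ t
  wrap-injective {s} {t} s<r t<r eq = begin
    s          ≡⟨ m<n⇒m%n≡m s<r ⟨
    s % suc m  ≡⟨ toℕ-wrap s ⟨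
    toℕ (wrap s) ≡⟨ cong toℕ eq ⟩
    toℕ (wrap t) ≡⟨ toℕ-wrap t ⟩
    t % suc m  ≡⟨ m<n⇒m%n≡m t<r ⟩
    t          ∎
    where open ≡-Reasoning

  wrap-+-cong : ∀ s t u → wrap s ≡ wrap t → wrap (s + u) ≡ wrap (t + u)
  wrap-+-cong s t u eq = toℕ-injective (begin
    toℕ (wrap (s + u))  ≡⟨ toℕ-wrap (s + u) ⟩
    (s + u) % suc m     ≡⟨ %-+-cong s t u (trans (sym (toℕ-wrap s)) (trans (cong toℕ eq) (toℕ-wrap t))) ⟩
    (t + u) % suc m     ≡⟨ toℕ-wrap (t + u) ⟨
    toℕ (wrap (t + u))  ∎)
    where open ≡-Reasoning

  wrap-shift-injective : ∀ {a s t} → a ≤ suc m → s < suc m → t < suc m →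
    wrap (a + s) ≡ wrap (a + t) → s ≡ t
  wrap-shift-injective {a} {s} {t} a≤r s<r t<r eq = wrap-injective s<r t<r (begin
    wrap s            ≡⟨ unshift s ⟨
    wrap (a + s + d)  ≡⟨ wrap-+-cong (a + s) (a + t) d eq ⟩
    wrap (a + t + d)  ≡⟨ unshift t ⟩
    wrap t            ∎)
    where
    open ≡-Reasoning
    -- Adding `d` completes the shift by `a` to a full period and thereby undoes it.
    d = suc m ∸ a
    unshift : ∀ s → wrap (a + s + d) ≡ wrap s
    unshift s = begin
      wrap (a + s + d)    ≡⟨ cong (λ z → wrap (z + d)) (+-comm a s) ⟩
      wrap (s + a + d)    ≡⟨ cong wrap (ℕ.+-assoc s a d) ⟩
      wrap (s + (a + d))  ≡⟨ cong (λ z → wrap (s + z)) (m+[n∸m]≡n a≤r) ⟩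
      wrap (s + suc m)    ≡⟨ wrap-period s ⟩
      wrap s              ∎

  next-≡ : ∀ (i : Fin (suc m)) → toℕ i < m → toℕ (next i) ≡ suc (toℕ i)
  next-≡ i i<m = trans (toℕ-fromℕ< _) (m<n⇒m%n≡m (s≤s i<m))

  next-last : ∀ (i : Fin (suc m)) → toℕ i ≡ m → toℕ (next i) ≡ 0
  next-last i eq = trans (toℕ-fromℕ< _) (trans (cong (λ z → suc z % suc m) eq) (n%n≡0 (suc m)))

-- Shifts by 2 and by 0 differ modulo a length of at least 3. This keeps a cycle from running back
-- along the edge just used.
next-next≢ : ∀ {m} (i : Fin (3 + m)) → ¬ next (next i) ≡ i
next-next≢ {m} i eq = contradiction
  (wrap-shift-injective (<⇒≤ (toℕ<n i)) (s≤s (s≤s (s≤s z≤n))) z<s wrap-eq) λ ()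
  where
  open ≡-Reasoning
  wrap-eq : wrap {2 + m} (toℕ i + 2) ≡ wrap (toℕ i + 0)
  wrap-eq = begin
    wrap (toℕ i + 2)           ≡⟨ cong wrap (+-comm (toℕ i) 2) ⟩
    wrap (2 + toℕ i)           ≡⟨ next-wrap (suc (toℕ i)) ⟨
    next (wrap (1 + toℕ i))    ≡⟨ cong next (next-wrap (toℕ i)) ⟨
    next (next (wrap (toℕ i))) ≡⟨ cong (next ∘ next) (wrap-toℕ i) ⟩
    next (next i)              ≡⟨ eq ⟩
    i                          ≡⟨ wrap-toℕ i ⟨
    wrap (toℕ i)               ≡⟨ cong wrap (+-identityʳ (toℕ i)) ⟨
    wrap (toℕ i + 0)           ∎

-- From saturation to paths avoiding a colour.

isPair⇒≡ : ∀ {n} (u v x y : Fin n) → isPair u v x y ≡ true →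
  (x ≡ u × y ≡ v) ⊎ (x ≡ v × y ≡ u)
isPair⇒≡ u v x y eq with x ≟ u | y ≟ v | x ≟ v | y ≟ u
... | yes a | yes b | _     | _     = inj₁ (a , b)
... | yes _ | no _  | yes c | yes d = inj₂ (c , d)
... | no _  | _     | yes c | yes d = inj₂ (c , d)

module _ {n : ℕ} (G : Graph n) (c : Coloring n) where

  -- Here `m` counts edges and `k` is the colour to avoid. Positions are plain naturals, constrained
  -- only up to `m`, so that places near either end can be compared without casts.
  record Path (m k : ℕ) (u v : Fin n) : Set where
    field
      vertex    : ℕ → Fin n
      start     : vertex 0 ≡ u
      end       : vertex m ≡ v
      injective : ∀ {i j} → i ≤ m → j ≤ m → vertex i ≡ vertex j → i ≡ j
      edge      : ∀ {i} → i < m → adj G (vertex i) (vertex (suc i)) ≡ true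
      colour≢   : ∀ {i} → i < m → ¬ c (vertex i) (vertex (suc i)) ≡ k

  reverse : IsEdgeColoring G c → ∀ {m k u v} → Path (suc m) k u v → Path (suc m) k v u
  reverse col {m} {k} P = record
    { vertex    = λ i → vertex (suc m ∸ i)
    ; start     = end
    ; end       = trans (cong vertex (n∸n≡0 (suc m))) start
    ; injective = λ {i} {j} i≤ j≤ eq →
        ∸-cancelˡ-≡ i≤ j≤ (injective (m∸n≤m (suc m) i) (m∸n≤m (suc m) j) eq)
    ; edge      = λ i< → proj₁ (step i<)
    ; colour≢   = λ i< → proj₂ (step i<)
    }
    where
    open Path P
    step : ∀ {i} → i < suc m →
      adj G (vertex (suc m ∸ i)) (vertex (m ∸ i)) ≡ true ×
      ¬ c (vertex (suc m ∸ i)) (vertex (m ∸ i)) ≡ k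
    step {i} (s≤s i≤m) rewrite +-∸-assoc 1 i≤m =
      trans (symm G _ _) e , λ eq → colour≢ j< (trans (col _ _ e) eq)
      where
      j< : m ∸ i < suc m
      j< = s≤s (m∸n≤m m i)
      e = edge j<

  -- The cycle is cut open at the step leaving `i₀` and renumbered from `next i₀`.
  cycle⇒path : ∀ {m k} (f : Fin (suc m) → Fin n) → Injective _≡_ _≡_ f → (i₀ : Fin (suc m)) →
    (∀ i → ¬ i ≡ i₀ → adj G (f i) (f (next i)) ≡ true × ¬ c (f i) (f (next i)) ≡ k) →
    Path m k (f (next i₀)) (f i₀)
  cycle⇒path {m} {k} f finj i₀ step = record
    { vertex    = λ s → f (wrap (a + s))
    ; start     = cong f (cong wrap (+-identityʳ a))
    ; end       = cong f last
    ; injective = λ i≤ j≤ eq → wrap-shift-injective (toℕ<n i₀) (s≤s i≤) (s≤s j≤) (finj eq)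
    ; edge      = λ i< → proj₁ (step′ i<)
    ; colour≢   = λ i< → proj₂ (step′ i<)
    }
    where
    a = suc (toℕ i₀)
    last : wrap (a + m) ≡ i₀
    last = trans (cong wrap (sym (+-suc (toℕ i₀) m))) (trans (wrap-period (toℕ i₀)) (wrap-toℕ i₀))
    step′ : ∀ {s} → s < m →
      adj G (f (wrap (a + s))) (f (wrap (a + suc s))) ≡ true ×
      ¬ c (f (wrap (a + s))) (f (wrap (a + suc s))) ≡ k
    step′ {s} s<m = subst (λ z → adj G (f (wrap (a + s))) (f z) ≡ true × ¬ c (f (wrap (a + s))) (f z) ≡ k)
      (trans (next-wrap (a + s)) (cong wrap (sym (+-suc a s))))
      -- The omitted index `i₀` sits at `s = m`, so no earlier position meets it.
      (step (wrap (a + s)) λ eq → ℕ.<⇒≢ s<m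
        (wrap-shift-injective (toℕ<n i₀) (s≤s (<⇒≤ s<m)) ≤-refl (trans eq (sym last))))

  -- The cycle created by adding `uv` must use it, since otherwise it would already be a rainbow
  -- cycle of `G`. Removing `uv` leaves the path, and `k` does not recur on it because `uv` carries
  -- `k`. With `k` the colour of an edge, the path avoids that edge.
  saturated⇒path : IsEdgeColoring G c → ∀ {m} → RainbowSaturated (2 + m) G c →
    ∀ {u v} → ¬ u ≡ v → adj G u v ≡ false → ∀ k → Path (suc m) k u v
  saturated⇒path col {m} (noCycle , sat) {u} {v} u≢v u≁v k
    with f , finj , fadj , frain ← sat u v u≢v u≁v k
    with any? (λ i → isPair u v (f i) (f (next i)) 𝔹.≟ true)
  ... | no none = contradiction (f , (λ {_} {_} → finj) , edges , rainbow) noCycle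
    where
    old : ∀ i → isPair u v (f i) (f (next i)) ≡ false
    old i = ¬-not (λ eq → none (i , eq))
    edges : ∀ i → adj G (f i) (f (next i)) ≡ true
    edges i = trans (sym (trans (cong (adj G (f i) (f (next i)) ∨_) (old i)) (∨-identityʳ _))) (fadj i)
    rainbow : ∀ i j → c (f i) (f (next i)) ≡ c (f j) (f (next j)) → i ≡ j
    rainbow i j eq = frain i j (trans (colour i) (trans eq (sym (colour j))))
      where
      colour : ∀ i → addEdgeCol c u v k (f i) (f (next i)) ≡ c (f i) (f (next i))
      colour i = cong (λ b → if b then k else c (f i) (f (next i))) (old i)
  ... | yes (i₀ , pair) = orient (isPair⇒≡ u v (f i₀) (f (next i₀)) pair)
    where
    col₀ : addEdgeCol c u v k (f i₀) (f (next i₀)) ≡ k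
    col₀ = cong (λ b → if b then k else c (f i₀) (f (next i₀))) pair
    step : ∀ i → ¬ i ≡ i₀ → adj G (f i) (f (next i)) ≡ true × ¬ c (f i) (f (next i)) ≡ k
    step i i≢ with isPair u v (f i) (f (next i)) in old | frain i i₀ | fadj i
    -- A second passage along the added pair would repeat the colour `k`.
    ... | true  | fr | _ = contradiction (fr (sym col₀)) i≢
    ... | false | fr | e = trans (sym (∨-identityʳ _)) e , λ eq → i≢ (fr (trans eq (sym col₀)))
    orient : (f i₀ ≡ u × f (next i₀) ≡ v) ⊎ (f i₀ ≡ v × f (next i₀) ≡ u) → Path (suc m) k u v
    orient (inj₁ (refl , refl)) = reverse col (cycle⇒path f finj i₀ step)
    orient (inj₂ (refl , refl)) = cycle⇒path f finj i₀ step

  -- Under a rainbow colouring every cycle is rainbow: equal colours mean equal edges, and an edge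
  -- met again in the opposite direction is excluded by `next-next≢`.
  noRainbowCycle : IsRainbowColoring G c → ∀ {m} → ¬ HasRainbowCycle (3 + m) (adj G) c →
    (q : ℕ → Fin n) → (∀ {i j} → i ≤ 2 + m → j ≤ 2 + m → q i ≡ q j → i ≡ j) →
    (∀ {i} → i < 2 + m → adj G (q i) (q (suc i)) ≡ true) →
    ¬ adj G (q (2 + m)) (q 0) ≡ true
  noRainbowCycle rb {m} noCycle q q-inj edge close = noCycle (f , (λ {_} {_} → f-inj) , edges , rainbow)
    where
    f : Fin (3 + m) → Fin n
    f i = q (toℕ i)
    f-inj : ∀ {i j} → f i ≡ f j → i ≡ j
    f-inj {i} {j} eq = toℕ-injective (q-inj (toℕ≤pred[n] i) (toℕ≤pred[n] j) eq)
    edges : ∀ i → adj G (f i) (f (next i)) ≡ true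
    edges i with ℕ.m≤n⇒m<n∨m≡n (toℕ≤pred[n] i)
    ... | inj₁ i< = trans (cong (λ z → adj G (f i) (q z)) (next-≡ i i<)) (edge i<)
    ... | inj₂ i≡ = trans (cong₂ (λ y z → adj G (q y) (q z)) i≡ (next-last i i≡)) close
    rainbow : ∀ i j → c (f i) (f (next i)) ≡ c (f j) (f (next j)) → i ≡ j
    rainbow i j eq with rb _ _ _ _ (edges i) (edges j) eq
    ... | inj₁ (a , _) = f-inj a
    ... | inj₂ (a , b) = contradiction
      (trans (cong next (f-inj b)) (sym (f-inj a))) (next-next≢ i)

-- Auxiliary facts on lists.

∈⇒↭ : ∀ {A : Set} {x : A} {xs} → x ∈ xs → ∃ λ ys → xs ↭ x ∷ ys
∈⇒↭ {x = x} x∈xs with ys , zs , refl ← ∈-∃++ x∈xs = _ , shift x ys zs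

-- Pigeonhole: if every vertex occurred in `xs`, positions would inject `Fin n` into a shorter list.
∃-∉ : ∀ {n} (xs : List (Fin n)) → length xs < n → ∃ λ y → y ∉ xs
∃-∉ {n} xs len< = ¬∀⟶∃¬ n _ (λ y → DecMembership._∈?_ _≟_ y xs) λ all∈ →
  ℕ.<⇒≱ len< (injective⇒≤ λ {x} {y} → index-injective (setoid _) (all∈ x) (all∈ y))

sum≤length : ∀ {A : Set} (f : A → ℕ) {xs} → All (λ y → f y ≤ 1) xs → sum (map f xs) ≤ length xs
sum≤length f []         = z≤n
sum≤length f (px ∷ pxs) = +-mono-≤ px (sum≤length f pxs)

triple : ∀ l → l + l + l ≡ l * 3
triple = solve-∀

double+single : ∀ l → l * 2 + l ≡ l * 3
double+single = solve-∀

-- Neighbourhoods, degree two and the discharging weight.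

module _ {n : ℕ} (G : Graph n) where

  -- As a list, it makes degrees lengths; a statement `N x ↭ a ∷ b ∷ []` fixes the degree and names
  -- the neighbours in whichever order is convenient.
  N : Fin n → List (Fin n)
  N x = filter (λ y → adj G x y 𝔹.≟ true) (allFin n)

  module _ {x : Fin n} {xs} (Nx : N x ↭ xs) where

    adj⇒∈ : ∀ {y} → adj G x y ≡ true → y ∈ xs
    adj⇒∈ e = ∈-resp-↭ Nx (∈-filter⁺ _ (∈-allFin _) e)

    ∈⇒adj : ∀ {y} → y ∈ xs → adj G x y ≡ true
    ∈⇒adj y∈ = proj₂ (∈-filter⁻ (λ y → adj G x y 𝔹.≟ true) {xs = allFin n} (∈-resp-↭ (↭-sym Nx) y∈))

    ∉⇒¬adj : ∀ {y} → y ∉ xs → adj G x y ≡ false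
    ∉⇒¬adj y∉ = ¬-not (λ e → y∉ (adj⇒∈ e))

    unique : Unique xs
    unique = Unique-resp-↭ (setoid _) (↭⇒↭ₛ Nx) (Unique.filter⁺ _ (Unique.allFin⁺ n))

  adj⇒≢ : ∀ {x y} → adj G x y ≡ true → ¬ x ≡ y
  adj⇒≢ e refl with () ← trans (sym e) (irrefl G _)

  adj-sym : ∀ {x y} → adj G x y ≡ true → adj G y x ≡ true
  adj-sym {x} {y} e = trans (symm G y x) e

  orient : ∀ {x y a b} → N y ↭ a ∷ b ∷ [] → adj G x y ≡ true → ∃ λ z → N y ↭ x ∷ z ∷ []
  orient Ny e with adj⇒∈ Ny (adj-sym e)
  ... | here refl         = _ , Ny
  ... | there (here refl) = _ , ↭-trans Ny (↭-swap _ _ ↭-refl)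

  isTwo : ℕ → ℕ
  isTwo 2 = 1
  isTwo _ = 0

  δ : Fin n → ℕ
  δ y = isTwo (length (N y))

  -- Across an edge xy, the vertex x receives h x − h y; so h is 2 on the
  -- degree-2 vertices of a triangle, 1 on the other degree-2 vertices, else 0.
  h : Fin n → ℕ
  h y = δ y * (1 + sum (map δ (N y)))

  δ≡ : ∀ {y ys} → N y ↭ ys → δ y ≡ isTwo (length ys)
  δ≡ Ny = cong isTwo (↭-length Ny)

  δ≡0⇒h≡0 : ∀ {y} → δ y ≡ 0 → h y ≡ 0
  δ≡0⇒h≡0 eq = cong (_* (1 + sum (map δ (N _)))) eq

  h-deg2 : ∀ {y a b} → N y ↭ a ∷ b ∷ [] → h y ≡ 1 + (δ a + δ b)
  h-deg2 {a = a} {b} Ny rewrite δ≡ Ny | sum-↭ (map⁺ δ Ny) | ℕ.+-identityʳ (δ b)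
    = ℕ.+-identityʳ _

  deg2? : ∀ y → δ y ≡ 0 ⊎ ∃₂ λ a b → N y ↭ a ∷ b ∷ []
  deg2? y with N y
  ... | []               = inj₁ refl
  ... | _ ∷ []           = inj₁ refl
  ... | a ∷ b ∷ []       = inj₂ (a , b , ↭-refl)
  ... | _ ∷ _ ∷ _ ∷ _    = inj₁ refl

  Triangle : Fin n → Fin n → Fin n → Set
  Triangle u u′ x = N u ↭ u′ ∷ x ∷ [] × N u′ ↭ u ∷ x ∷ []

-- Local structure of saturated graphs, with cycle length `6 + k`.

module Saturated {n k : ℕ} (G : Graph n) (c : Coloring n) (r≤n : 6 + k ≤ n)
  (col : IsEdgeColoring G c) (rainbow : IsRainbowColoring G c)
  (sat : RainbowSaturated (6 + k) G c) where

  private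
    -- Abstract: unfolding the extracted paths would make conversion checking intractable.
    abstract
      path : ∀ {xs u v} → N G u ↭ xs → v ∉ u ∷ xs → ∀ a → Path G c (5 + k) a u v
      path Nu v∉ = saturated⇒path G c col sat (λ u≡v → v∉ (here (sym u≡v)))
        (∉⇒¬adj G Nu (λ v∈ → v∉ (there v∈)))

    -- The implicit test is settled by evaluation, so a literal position below 5 needs no proof.
    lt : ∀ i {_ : T (i <ᵇ 5)} → i < 5 + k
    lt i {p} = ≤-trans (<ᵇ⇒< i 5 p) (m≤m+n 5 k)

    le : ∀ i {_ : T (i <ᵇ 5)} → i ≤ 5 + k
    le i {p} = <⇒≤ (lt i {p})

    -- The recurring `with () ← same ...` refutes a vertex being visited at two positions that are
    -- visibly different.
    module Walk {a u v} (P : Path G c (5 + k) a u v) where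
      open Path P public

      after : ∀ {i x} → i < 5 + k → vertex i ≡ x → adj G x (vertex (suc i)) ≡ true
      after i< refl = edge i<

      before : ∀ {i x} → i < 5 + k → vertex (suc i) ≡ x → adj G x (vertex i) ≡ true
      before i< refl = adj-sym G (edge i<)

      same : ∀ {i j x} → i ≤ 5 + k → j ≤ 5 + k → vertex i ≡ x → vertex j ≡ x → i ≡ j
      same i≤ j≤ p q = injective i≤ j≤ (trans p (sym q))

      avoid : ∀ {i x y} → i < 5 + k → vertex i ≡ x → vertex (suc i) ≡ y → ¬ c x y ≡ a
      avoid i< refl refl = colour≢ i<

  ∃-far : ∀ xs {_ : T (length xs <ᵇ 6)} → ∃ λ y → y ∉ xs
  ∃-far xs {p} = ∃-∉ xs (≤-trans (<ᵇ⇒< (length xs) 6 p) (≤-trans (m≤m+n 6 k) r≤n))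

  degree≢0 : ∀ {x} → ¬ (N G x ↭ [])
  degree≢0 {x} Nx with y , y∉ ← ∃-far (x ∷ []) = first (adj⇒∈ G Nx (after (lt 0) start))
    where
    open Walk (path Nx y∉ 0)
    first : ¬ vertex 1 ∈ []
    first ()

  -- Forbidding the colour of the only edge at `x` leaves a path to a fresh vertex no first step.
  degree≢1 : ∀ {x a} → ¬ (N G x ↭ a ∷ [])
  degree≢1 {x} {a} Nx with y , y∉ ← ∃-far (x ∷ a ∷ []) = first (adj⇒∈ G Nx (after (lt 0) start))
    where
    open Walk (path Nx y∉ (c x a))
    first : ¬ vertex 1 ∈ a ∷ []
    first (here e) = avoid (lt 0) start e refl

  -- If `x` and `y` differ, then `y` is not adjacent to `u`. A path from `u` to `y` avoiding the
  -- edge `ux` must go through `u′`, and then reaches `y` at position 2, too early.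
  adjacent-deg2 : ∀ {u u′ x y} → N G u ↭ u′ ∷ x ∷ [] → N G u′ ↭ u ∷ y ∷ [] → x ≡ y
  adjacent-deg2 {u} {u′} {x} {y} Nu Nu′ with x ≟ y | unique G Nu′
  ... | yes x≡y | _ = x≡y
  ... | no x≢y | (u≢y ∷ _) ∷ _ = ⊥-elim (case₁ (adj⇒∈ G Nu (after (lt 0) start)))
    where
    y∉ : y ∉ u ∷ u′ ∷ x ∷ []
    y∉ (here refl)                 = u≢y refl
    y∉ (there (here refl))         = adj⇒≢ G (∈⇒adj G Nu′ (there (here refl))) refl
    y∉ (there (there (here refl))) = x≢y refl
    open Walk (path Nu y∉ (c u x))
    case₂ : vertex 1 ≡ u′ → vertex 2 ∈ u ∷ y ∷ [] → ⊥
    case₂ _ (here e)         with () ← same (le 2) (le 0) e start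
    case₂ _ (there (here e)) with () ← same (le 2) ≤-refl e end
    case₁ : vertex 1 ∈ u′ ∷ x ∷ [] → ⊥
    case₁ (here e)         = case₂ e (adj⇒∈ G Nu′ (after (lt 1) e))
    case₁ (there (here e)) = avoid (lt 0) start e refl

  triangle : ∀ {u u′ x a b} → N G u ↭ u′ ∷ x ∷ [] → N G u′ ↭ a ∷ b ∷ [] → Triangle G u u′ x
  triangle Nu Nu′ with z , Nu′₂ ← orient G Nu′ (∈⇒adj G Nu (here refl))
    with refl ← adjacent-deg2 Nu Nu′₂ = Nu , Nu′₂

  -- Triangles with two vertices of degree two.

  module _ {u u′ x} (tri : Triangle G u u′ x) where
    private
      Nu  = proj₁ tri
      Nu′ = proj₂ tri

    -- Apart from each other, `u` and `u′` are adjacent only to `x`, and `u` cannot be revisited.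
    exit : ∀ {a v} (P : Path G c (5 + k) a u v) → let open Path P in
      vertex 1 ≡ x ⊎ (vertex 1 ≡ u′ × vertex 2 ≡ x)
    exit P = first (adj⇒∈ G Nu (after (lt 0) start))
      where
      open Walk P
      second : vertex 1 ≡ u′ → vertex 2 ∈ u ∷ x ∷ [] → vertex 1 ≡ u′ × vertex 2 ≡ x
      second e (there (here e₂)) = e , e₂
      second _ (here e₂) with () ← same (le 2) (le 0) e₂ start
      first : vertex 1 ∈ u′ ∷ x ∷ [] → vertex 1 ≡ x ⊎ (vertex 1 ≡ u′ × vertex 2 ≡ x)
      first (here e)         = inj₂ (second e (adj⇒∈ G Nu′ (after (lt 1) e)))
      first (there (here e)) = inj₁ e

    -- A path from `u` to `y` avoiding the edge `xz` gets stuck at `x`: `u` and `u′` are used up or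
    -- lead nowhere, `y` would come too early, and `z` is forbidden. Bounding the neighbourhood only
    -- from above lets one argument exclude degrees 2, 3 and 4.
    apex-large : ∀ {y} z → y ∉ u ∷ u′ ∷ x ∷ [] →
      ¬ (∀ {w} → adj G x w ≡ true → w ∈ u ∷ u′ ∷ y ∷ z ∷ [])
    apex-large {y} z y∉ Nx = leave (exit P)
      where
      P = path Nu y∉ (c x z)
      open Walk P
      leave : ¬ (vertex 1 ≡ x ⊎ (vertex 1 ≡ u′ × vertex 2 ≡ x))
      leave (inj₁ e₁) with Nx (after (lt 1) e₁)
      ... | here e                         with () ← same (le 2) (le 0) e start
      ... | there (there (here e))         with () ← same (le 2) ≤-refl e end
      ... | there (there (there (here e))) = avoid (lt 1) e₁ e refl
      ... | there (here e₂) with adj⇒∈ G Nu′ (after (lt 2) e₂)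
      ...   | here e         with () ← same (le 3) (le 0) e start
      ...   | there (here e) with () ← same (le 3) (le 1) e e₁
      leave (inj₂ (e₁ , e₂)) with Nx (after (lt 2) e₂)
      ... | here e                         with () ← same (le 3) (le 0) e start
      ... | there (here e)                 with () ← same (le 3) (le 1) e e₁
      ... | there (there (here e))         with () ← same (le 3) ≤-refl e end
      ... | there (there (there (here e))) = avoid (lt 2) e₂ e refl

    apex : ∃ λ rest → N G x ↭ u ∷ u′ ∷ rest × 3 ≤ length rest
    apex with ys , Nx ← ∈⇒↭ (adj⇒∈ G ↭-refl (adj-sym G (∈⇒adj G Nu (there (here refl)))))
      with adj⇒∈ G Nx (adj-sym G (∈⇒adj G Nu′ (there (here refl))))
    ... | here eq = contradiction (sym eq) (adj⇒≢ G (∈⇒adj G Nu (here refl)))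
    ... | there u′∈ with rest , ys↭ ← ∈⇒↭ u′∈ = rest , Nx′ , long rest Nx′
      where
      Nx′ = ↭-trans Nx (↭-prep u ys↭)
      fresh : ∀ {y zs} → N G x ↭ u ∷ u′ ∷ y ∷ zs → y ∉ u ∷ u′ ∷ x ∷ []
      fresh Nx₁ y∈ with unique G Nx₁ | y∈
      ... | (_ ∷ u≢y ∷ _) ∷ _ | here refl = u≢y refl
      ... | _ ∷ (u′≢y ∷ _) ∷ _ | there (here refl) = u′≢y refl
      ... | _ | there (there (here refl)) = adj⇒≢ G (∈⇒adj G Nx₁ (there (there (here refl)))) refl
      long : ∀ zs → N G x ↭ u ∷ u′ ∷ zs → 3 ≤ length zs
      -- With no further neighbour, any vertex outside the triangle serves as the target.
      long [] Nx₁ with y , y∉ ← ∃-far (u ∷ u′ ∷ x ∷ []) =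
        ⊥-elim (apex-large y y∉ λ e → widen (adj⇒∈ G Nx₁ e))
        where
        widen : ∀ {w zs} → w ∈ u ∷ u′ ∷ [] → w ∈ u ∷ u′ ∷ zs
        widen (here e)         = here e
        widen (there (here e)) = there (here e)
      -- The single further neighbour is both the target and the end of the forbidden edge.
      long (y ∷ []) Nx₁ = ⊥-elim (apex-large y (fresh Nx₁) λ e → widen (adj⇒∈ G Nx₁ e))
        where
        widen : ∀ {w} → w ∈ u ∷ u′ ∷ y ∷ [] → w ∈ u ∷ u′ ∷ y ∷ y ∷ []
        widen (here e)                 = here e
        widen (there (here e))         = there (here e)
        widen (there (there (here e))) = there (there (here e))
      long (y ∷ z ∷ []) Nx₁ = ⊥-elim (apex-large z (fresh Nx₁) (adj⇒∈ G Nx₁))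
      long (_ ∷ _ ∷ _ ∷ _) _ = s≤s (s≤s (s≤s z≤n))

    apex-δ : δ G x ≡ 0
    apex-δ with apex
    ... | _ ∷ _ , Nx , _ = δ≡ G Nx
    ... | [] , _ , ()

    h-triangle : h G u ≡ 2
    h-triangle rewrite h-deg2 G Nu | δ≡ G Nu′ | apex-δ = refl

    -- A path from `u` to the end `w` of a second triangle leaves the first through `x` at position
    -- 1 or 2 and enters the second through `x` at position `3 + k` or `4 + k`. So `x` would be
    -- visited twice.
    triangle-unique : ∀ {w w′} → Triangle G w w′ x → w ≡ u ⊎ w ≡ u′
    triangle-unique {w} {w′} (Nw , Nw′) with w ≟ u | w ≟ u′
    ... | yes w≡u | _        = inj₁ w≡u
    ... | _       | yes w≡u′ = inj₂ w≡u′
    ... | no w≢u  | no w≢u′  = ⊥-elim (enter (exit P) (adj⇒∈ G Nw (before ≤-refl end)))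
      where
      w∉ : w ∉ u ∷ u′ ∷ x ∷ []
      w∉ (here e)                    = w≢u e
      w∉ (there (here e))            = w≢u′ e
      w∉ (there (there (here refl))) = adj⇒≢ G (∈⇒adj G Nw (there (here refl))) refl
      -- The colour 0 is an arbitrary choice.
      P = path Nu w∉ 0
      open Walk P
      enter : vertex 1 ≡ x ⊎ (vertex 1 ≡ u′ × vertex 2 ≡ x) → vertex (4 + k) ∈ w′ ∷ x ∷ [] → ⊥
      enter (inj₁ e₁) (there (here e)) with () ← same (le 1) (n≤1+n _) e₁ e
      enter (inj₂ (_ , e₂)) (there (here e)) with () ← same (le 2) (n≤1+n _) e₂ e
      enter ex (here e′) with adj⇒∈ G Nw′ (before (n≤1+n _) e′) | ex
      ... | here e         | _ with () ← same (≤-trans (n≤1+n _) (n≤1+n _)) ≤-refl e end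
      ... | there (here e) | inj₁ e₁ with () ← same (le 1) (≤-trans (n≤1+n _) (n≤1+n _)) e₁ e
      ... | there (here e) | inj₂ (_ , e₂) with () ← same (le 2) (≤-trans (n≤1+n _) (n≤1+n _)) e₂ e

  -- Vertices of degree three.

  module _ {w u u′ z a b : Fin n} (Nw : N G w ↭ u ∷ u′ ∷ z ∷ [])
    (Nu : N G u ↭ w ∷ a ∷ []) (Nu′ : N G u′ ↭ w ∷ b ∷ []) where
    private
      w≢u′ : ¬ w ≡ u′
      w≢u′ = adj⇒≢ G (∈⇒adj G Nw (there (here refl)))

      not-triangle : ¬ Triangle G u u′ w
      not-triangle tri with unique G Nw
      ... | (_ ∷ u≢z ∷ _) ∷ (u′≢z ∷ _) ∷ _ = apex-large tri z z∉ λ e → widen (adj⇒∈ G Nw e)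
        where
        z∉ : z ∉ u ∷ u′ ∷ w ∷ []
        z∉ (here refl)                 = u≢z refl
        z∉ (there (here refl))         = u′≢z refl
        z∉ (there (there (here refl))) = adj⇒≢ G (∈⇒adj G Nw (there (there (here refl)))) refl
        widen : ∀ {y} → y ∈ u ∷ u′ ∷ z ∷ [] → y ∈ u ∷ u′ ∷ z ∷ z ∷ []
        widen (here e)                 = here e
        widen (there (here e))         = there (here e)
        widen (there (there (here e))) = there (there (here e))

      u≁u′ : ¬ adj G u u′ ≡ true
      u≁u′ e with adj⇒∈ G Nu e
      ... | here refl = w≢u′ refl
      ... | there (here refl) =
        not-triangle (triangle (↭-trans Nu (↭-swap _ _ ↭-refl)) Nu′)

      -- If `a` and `b` agree, a path from `u` to `u′` avoiding the edge `wz` starts or finishes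
      -- through `w`, as `a` can serve only one end. There `w` has only `u`, `u′` and the forbidden
      -- `z` to offer.
      a≢b : ¬ a ≡ b
      a≢b refl with unique G Nw
      ... | (u≢u′ ∷ _) ∷ _ = first (adj⇒∈ G Nu (after (lt 0) start))
        where
        u′∉ : u′ ∉ u ∷ w ∷ a ∷ []
        u′∉ (here e) = u≢u′ (sym e)
        u′∉ (there u′∈) = u≁u′ (∈⇒adj G Nu u′∈)
        open Walk (path Nu u′∉ (c w z))
        -- Near the end of the path the edge would be crossed from `z` to `w`, so its colour is
        -- needed in that order too.
        c-sym : c z w ≡ c w z
        c-sym = sym (col w z (∈⇒adj G Nw (there (there (here refl)))))
        penultimate : vertex (3 + k) ∈ u ∷ u′ ∷ z ∷ [] → vertex (4 + k) ≡ w → ⊥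
        penultimate (here e) _ with () ← same (≤-trans (n≤1+n _) (n≤1+n _)) (le 0) e start
        penultimate (there (here e)) _ = ℕ.m≢1+n+m (3 + k) {1}
          (same (≤-trans (n≤1+n _) (n≤1+n _)) ≤-refl e end)
        penultimate (there (there (here e))) e′ = avoid (n≤1+n _) e e′ c-sym
        final : vertex 1 ≡ a → vertex (4 + k) ∈ w ∷ a ∷ [] → ⊥
        final _ (here e)         = penultimate (adj⇒∈ G Nw (before (n≤1+n _) e)) e
        final e (there (here f)) with () ← same (le 1) (n≤1+n _) e f
        second : vertex 1 ≡ w → vertex 2 ∈ u ∷ u′ ∷ z ∷ [] → ⊥
        second _ (here e) with () ← same (le 2) (le 0) e start
        second _ (there (here e)) with () ← same (le 2) ≤-refl e end
        second e (there (there (here e₂))) = avoid (lt 1) e e₂ refl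
        first : vertex 1 ∈ w ∷ a ∷ [] → ⊥
        first (here e)         = second e (adj⇒∈ G Nw (after (lt 1) e))
        first (there (here e)) = final e (adj⇒∈ G Nu′ (before ≤-refl end))

      b∉ : b ∉ u ∷ w ∷ a ∷ []
      b∉ (here refl) = u≁u′ (adj-sym G (∈⇒adj G Nu′ (there (here refl))))
      b∉ (there (here refl)) with unique G Nu′
      ... | (w≢b ∷ _) ∷ _ = w≢b refl
      b∉ (there (there (here refl))) = a≢b refl

    -- A path from u to b that avoids the edge ua runs u, w, z, …, b;
    -- replacing u by u′ closes it up to a cycle of the same length.
    deg3-deg2-unique : ⊥
    deg3-deg2-unique = first (adj⇒∈ G Nu (after (lt 0) start))
      where
      open Walk (path Nu b∉ (c u a))

      close : vertex 1 ≡ w → vertex 2 ≡ z → ⊥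
      close e₁ e₂ = noRainbowCycle G c rainbow (proj₁ sat) q q-injective q-edge
        (trans (cong₂ (adj G) q-last e₁) (∈⇒adj G Nu′ (here refl)))
        where
        -- The path could enter `u′` only from `w`, which it leaves towards `z`, or from `b`, where
        -- it ends.
        u′-fresh : ∀ i → i < 5 + k → ¬ vertex (suc i) ≡ u′
        u′-fresh zero _ e = w≢u′ (trans (sym e₁) e)
        u′-fresh (suc i) i< e with adj⇒∈ G Nu′ (before i< e) | unique G Nw
        ... | here f | _ ∷ (u′≢z ∷ _) ∷ _ with refl ← same (<⇒≤ i<) (le 1) f e₁ =
          u′≢z (trans (sym e) e₂)
        u′-fresh (suc i) i< e | there (here f) | _ = ℕ.<⇒≢ i< (same (<⇒≤ i<) ≤-refl f end)

        -- Position 0, holding `u`, is dropped, the rest moves down by one, and `u′` fills the last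
        -- place.
        q : ℕ → Fin n
        q i with i <? 5 + k
        ... | yes _ = vertex (suc i)
        ... | no _  = u′

        q-last : q (5 + k) ≡ u′
        q-last with 5 + k <? 5 + k
        ... | yes m<m = contradiction m<m (ℕ.n≮n _)
        ... | no _    = refl

        q-injective : ∀ {i j} → i ≤ 5 + k → j ≤ 5 + k → q i ≡ q j → i ≡ j
        q-injective {i} {j} i≤ j≤ eq with i <? 5 + k | j <? 5 + k
        ... | yes i< | yes j< = ℕ.suc-injective (injective i< j< eq)
        ... | yes i< | no _   = contradiction eq (u′-fresh i i<)
        ... | no _   | yes j< = contradiction (sym eq) (u′-fresh j j<)
        ... | no i≮  | no j≮  = trans (≤-antisym i≤ (ℕ.≮⇒≥ i≮)) (≤-antisym (ℕ.≮⇒≥ j≮) j≤)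

        q-edge : ∀ {i} → i < 5 + k → adj G (q i) (q (suc i)) ≡ true
        q-edge {i} i< with i <? 5 + k | suc i <? 5 + k
        ... | no i≮ | _         = contradiction i< i≮
        ... | yes _ | yes 1+i<  = edge 1+i<
        ... | yes _ | no 1+i≮   = subst (λ y → adj G y u′ ≡ true)
          (trans (sym end) (cong vertex (≤-antisym (ℕ.≮⇒≥ 1+i≮) i<)))
          (adj-sym G (∈⇒adj G Nu′ (there (here refl))))

      second : vertex 1 ≡ w → vertex 2 ∈ u ∷ u′ ∷ z ∷ [] → ⊥
      -- A turn from `w` to `u′` leads back to `w` or to `b` at position 3, before the end.
      third  : vertex 1 ≡ w → vertex 2 ≡ u′ → vertex 3 ∈ w ∷ b ∷ [] → ⊥
      third e₁ _ (here e) with () ← same (le 3) (le 1) e e₁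
      third _ _ (there (here e)) with () ← same (le 3) ≤-refl e end
      second _ (here e) with () ← same (le 2) (le 0) e start
      second e₁ (there (here e)) = third e₁ e (adj⇒∈ G Nu′ (after (lt 2) e))
      second e₁ (there (there (here e))) = close e₁ e
      first : vertex 1 ∈ w ∷ a ∷ [] → ⊥
      first (here e)         = second e (adj⇒∈ G Nw (after (lt 1) e))
      first (there (here e)) = avoid (lt 0) start e refl

  -- The charge kept by each vertex.

  data Neighbours (x : Fin n) : Set where
    two   : ∀ a b → N G x ↭ a ∷ b ∷ [] → Neighbours x
    three : ∀ a b d → N G x ↭ a ∷ b ∷ d ∷ [] → Neighbours x
    many  : 4 ≤ length (N G x) → δ G x ≡ 0 → Neighbours x

  neighbours : ∀ x → Neighbours x
  neighbours x with N G x in eq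
  ... | []                = ⊥-elim (degree≢0 (↭-reflexive eq))
  ... | _ ∷ []            = ⊥-elim (degree≢1 (↭-reflexive eq))
  ... | a ∷ b ∷ []        = two a b (↭-reflexive eq)
  ... | a ∷ b ∷ d ∷ []    = three a b d (↭-reflexive eq)
  ... | _ ∷ _ ∷ _ ∷ _ ∷ _ = many (subst (λ ys → 4 ≤ length ys) (sym eq) (s≤s (s≤s (s≤s (s≤s z≤n)))))
                                 (cong (λ ys → isTwo G (length ys)) eq)

  -- The final charge, 3 plus `h x` minus `h y` summed over the neighbours `y`, is at least 8; the
  -- subtracted terms stand on the left to stay in ℕ.
  Bound : Fin n → List (Fin n) → Set
  Bound x ys = 8 + sum (map (h G) ys) ≤ length ys * (3 + h G x)

  Bound-resp-↭ : ∀ {x xs ys} → xs ↭ ys → Bound x ys → Bound x xs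
  Bound-resp-↭ {x} xs↭ys = subst₂ (λ s l → 8 + s ≤ l * (3 + h G x))
    (sym (sum-↭ (map⁺ (h G) xs↭ys))) (sym (↭-length xs↭ys))

  triangle-bound : ∀ {u u′ x} → Triangle G u u′ x → Bound u (u′ ∷ x ∷ [])
  triangle-bound {x = x} tri@(Nu , Nu′)
    -- The weights of `u`, `u′`, `x` are 2, 2, 0, so both sides equal 10.
    rewrite h-triangle tri | h-triangle (Nu′ , Nu) | δ≡0⇒h≡0 G {x} (apex-δ tri) = ≤-refl

  two-bound : ∀ {x a b} → N G x ↭ a ∷ b ∷ [] → Bound x (a ∷ b ∷ [])
  two-bound {x} {a} {b} Nx with deg2? G a | deg2? G b
  ... | inj₁ δa≡0 | inj₁ δb≡0
    rewrite h-deg2 G Nx | δ≡0⇒h≡0 G {a} δa≡0 | δ≡0⇒h≡0 G {b} δb≡0 | δa≡0 | δb≡0 = ≤-refl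
  ... | inj₂ (_ , _ , Na) | _ = triangle-bound (triangle Nx Na)
  ... | inj₁ _ | inj₂ (_ , _ , Nb) = Bound-resp-↭ {xs = a ∷ b ∷ []} {b ∷ a ∷ []} (↭-swap a b ↭-refl)
    (triangle-bound (triangle (↭-trans Nx (↭-swap a b ↭-refl)) Nb))

  -- A weight above 1 means that `u` has degree 2 and so has some neighbour. As `x` does not have
  -- degree 2, that neighbour is the other one, `u′`.
  heavy⇒triangle : ∀ {x u} → δ G x ≡ 0 → adj G x u ≡ true → ¬ h G u ≤ 1 → ∃ λ u′ → Triangle G u u′ x
  heavy⇒triangle {x} {u} δx≡0 e h≰1 with deg2? G u
  ... | inj₁ δu≡0 = contradiction (subst (_≤ 1) (sym (δ≡0⇒h≡0 G {u} δu≡0)) z≤n) h≰1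
  ... | inj₂ (_ , _ , Nu) with u′ , Nu₂ ← orient G Nu e with deg2? G u′
  ...   | inj₂ (_ , _ , Nu′) = u′ , triangle (↭-trans Nu₂ (↭-swap _ _ ↭-refl)) Nu′
  ...   | inj₁ δu′≡0 = contradiction (ℕ.≤-reflexive h≡1) h≰1
    where
    h≡1 : h G u ≡ 1
    h≡1 rewrite h-deg2 G Nu₂ | δx≡0 | δu′≡0 = refl

  -- The apex gives 2 to each of `u` and `u′`, and by `triangle-unique` at most 1 to any other
  -- neighbour.
  apex-bound : ∀ {x u u′} → δ G x ≡ 0 → Triangle G u u′ x → Bound x (N G x)
  apex-bound {x} {u} {u′} δx≡0 tri@(Nu , Nu′) with rest , Nx , 3≤ ← apex tri =
    Bound-resp-↭ Nx bound
    where
    light : ∀ {w} → w ∈ rest → h G w ≤ 1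
    light {w} w∈ with h G w ≤? 1
    ... | yes h≤1 = h≤1
    ... | no h≰1 with _ , tri′ ← heavy⇒triangle δx≡0 (∈⇒adj G Nx (there (there w∈))) h≰1
      with unique G Nx | triangle-unique tri tri′
    ... | (_ ∷ u≢) ∷ _ | inj₁ refl = contradiction refl (All.lookup u≢ w∈)
    ... | _ ∷ u′≢ ∷ _  | inj₂ refl = contradiction refl (All.lookup u′≢ w∈)
    -- 12 is the 8 to be kept plus the 4 given to `u` and `u′`; since `12 + l ≤ 6 + 3 * l` amounts
    -- to `3 ≤ l`, degree 5 is just enough.
    arithmetic : ∀ {s l} → s ≤ l → 3 ≤ l → 12 + s ≤ (2 + l) * 3
    arithmetic {s} {l} s≤l 3≤l = begin
      12 + s           ≤⟨ ℕ.+-monoʳ-≤ 12 s≤l ⟩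
      6 + (3 + 3 + l)  ≤⟨ ℕ.+-monoʳ-≤ 6 (ℕ.+-monoˡ-≤ l (+-mono-≤ 3≤l 3≤l)) ⟩
      6 + (l + l + l)  ≡⟨ cong (6 +_) (triple l) ⟩
      (2 + l) * 3      ∎
      where
      open ℕ.≤-Reasoning
    bound : Bound x (u ∷ u′ ∷ rest)
    bound rewrite h-triangle tri | h-triangle (Nu′ , Nu) | δ≡0⇒h≡0 G {x} δx≡0 =
      arithmetic (sum≤length (h G) (All.tabulate light)) 3≤

  -- Of the initial 9 only 1 may be given away, and by `deg3-deg2-unique` at most one neighbour has
  -- degree 2.
  three-bound : ∀ {x a b d} → N G x ↭ a ∷ b ∷ d ∷ [] → All (λ y → h G y ≤ 1) (a ∷ b ∷ d ∷ []) →
    Bound x (a ∷ b ∷ d ∷ [])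
  three-bound {x} {a} {b} {d} Nx (ha ∷ hb ∷ hd ∷ [])
    rewrite δ≡0⇒h≡0 G {x} (δ≡ G Nx) = ℕ.+-monoʳ-≤ 8 sum≤1
    where
    clash : ∀ {u u′ z} → N G x ↭ u ∷ u′ ∷ z ∷ [] →
      (∃₂ λ a b → N G u ↭ a ∷ b ∷ []) → (∃₂ λ a b → N G u′ ↭ a ∷ b ∷ []) → ⊥
    clash Nx₁ (_ , _ , Nu) (_ , _ , Nu′) = deg3-deg2-unique Nx₁
      (proj₂ (orient G Nu (∈⇒adj G Nx₁ (here refl))))
      (proj₂ (orient G Nu′ (∈⇒adj G Nx₁ (there (here refl)))))
    sum≤1 : h G a + (h G b + (h G d + 0)) ≤ 1
    sum≤1 with deg2? G a | deg2? G b | deg2? G d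
    ... | inj₂ A | inj₂ B | _ = ⊥-elim (clash Nx A B)
    ... | inj₂ A | _ | inj₂ D = ⊥-elim (clash (↭-trans Nx (↭-prep _ (↭-swap _ _ ↭-refl))) A D)
    ... | _ | inj₂ B | inj₂ D =
      ⊥-elim (clash (↭-trans Nx (↭-trans (↭-swap _ _ ↭-refl) (↭-prep _ (↭-swap _ _ ↭-refl)))) B D)
    ... | inj₂ _ | inj₁ δb | inj₁ δd rewrite δ≡0⇒h≡0 G {b} δb | δ≡0⇒h≡0 G {d} δd | ℕ.+-identityʳ (h G a) = ha
    ... | inj₁ δa | inj₂ _ | inj₁ δd rewrite δ≡0⇒h≡0 G {a} δa | δ≡0⇒h≡0 G {d} δd | ℕ.+-identityʳ (h G b) = hb
    ... | inj₁ δa | inj₁ δb | inj₂ _ rewrite δ≡0⇒h≡0 G {a} δa | δ≡0⇒h≡0 G {b} δb | ℕ.+-identityʳ (h G d) = hd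
    ... | inj₁ δa | inj₁ δb | inj₁ δd rewrite δ≡0⇒h≡0 G {a} δa | δ≡0⇒h≡0 G {b} δb | δ≡0⇒h≡0 G {d} δd = z≤n

  heavy-bound : ∀ {x} → δ G x ≡ 0 → ¬ All (λ y → h G y ≤ 1) (N G x) → Bound x (N G x)
  heavy-bound {x} δx≡0 heavy
    with u , u∈ , h≰1 ← find (¬All⇒Any¬ (λ y → h G y ≤? 1) (N G x) heavy)
    with _ , tri ← heavy⇒triangle δx≡0 (∈⇒adj G ↭-refl u∈) h≰1 = apex-bound δx≡0 tri

  vertex-bound : ∀ x → Bound x (N G x)
  vertex-bound x with neighbours x | all? (λ y → h G y ≤? 1) (N G x)
  ... | two a b Nx     | _ = Bound-resp-↭ Nx (two-bound Nx)
  ... | three a b d Nx | yes light = Bound-resp-↭ Nx (three-bound Nx (All-resp-↭ Nx light))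
  ... | three a b d Nx | no heavy = heavy-bound (δ≡ G Nx) heavy
  ... | many _ δx≡0 | no heavy = heavy-bound δx≡0 heavy
  -- Giving at most 1 to each neighbour leaves twice the degree, hence at least 8.
  ... | many 4≤ δx≡0 | yes light rewrite δ≡0⇒h≡0 G {x} δx≡0 = begin
    8 + sum (map (h G) (N G x))   ≤⟨ +-mono-≤ (ℕ.*-monoˡ-≤ 2 4≤) (sum≤length (h G) light) ⟩
    length (N G x) * 2 + length (N G x) ≡⟨ double+single (length (N G x)) ⟩
    length (N G x) * 3            ∎
    where open ℕ.≤-Reasoning

-- Finite sums.

Σ[_]_ : ∀ {A : Set} → List A → (A → ℕ) → ℕ
Σ[ xs ] f = sum (map f xs)

module _ {A : Set} where

  Σ-cong : ∀ (xs : List A) {f g} → (∀ x → f x ≡ g x) → Σ[ xs ] f ≡ Σ[ xs ] g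
  Σ-cong []       eq = refl
  Σ-cong (x ∷ xs) eq = cong₂ _+_ (eq x) (Σ-cong xs eq)

  Σ-mono : ∀ (xs : List A) {f g} → (∀ x → f x ≤ g x) → Σ[ xs ] f ≤ Σ[ xs ] g
  Σ-mono []       le = z≤n
  Σ-mono (x ∷ xs) le = +-mono-≤ (le x) (Σ-mono xs le)

  Σ-+ : ∀ (xs : List A) f g → Σ[ xs ] (λ x → f x + g x) ≡ Σ[ xs ] f + Σ[ xs ] g
  Σ-+ []       f g = refl
  Σ-+ (x ∷ xs) f g rewrite Σ-+ xs f g = interchange (f x) (g x) (Σ[ xs ] f) (Σ[ xs ] g)
    where
    interchange : ∀ a b s t → a + b + (s + t) ≡ a + s + (b + t)
    interchange = solve-∀

  Σ-* : ∀ (xs : List A) f k → Σ[ xs ] (λ x → f x * k) ≡ (Σ[ xs ] f) * k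
  Σ-* []       f k = refl
  Σ-* (x ∷ xs) f k rewrite Σ-* xs f k = sym (ℕ.*-distribʳ-+ k (f x) (Σ[ xs ] f))

  Σ-const : ∀ (xs : List A) k → Σ[ xs ] (λ _ → k) ≡ length xs * k
  Σ-const []       k = refl
  Σ-const (x ∷ xs) k = cong (k +_) (Σ-const xs k)

  Σ-filter : ∀ (p : A → Bool) f xs →
    Σ[ filter (λ x → p x 𝔹.≟ true) xs ] f ≡ Σ[ xs ] (λ x → if p x then f x else 0)
  Σ-filter p f [] = refl
  Σ-filter p f (x ∷ xs) with p x
  ... | true  = cong (f x +_) (Σ-filter p f xs)
  ... | false = Σ-filter p f xs

Σ-swap : ∀ {A B : Set} (xs : List A) (ys : List B) (f : A → B → ℕ) →
  Σ[ xs ] (λ x → Σ[ ys ] (f x)) ≡ Σ[ ys ] (λ y → Σ[ xs ] (λ x → f x y))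
Σ-swap []       ys f = sym (trans (Σ-const ys 0) (ℕ.*-zeroʳ (length ys)))
Σ-swap (x ∷ xs) ys f rewrite Σ-swap xs ys f = sym (Σ-+ ys (f x) _)

-- Double counting and the global bound.

module _ {n : ℕ} (G : Graph n) where
  private V = allFin n

  -- Both sides sum over ordered adjacent pairs, read from opposite ends. Hence discharging only
  -- moves charge: total gains equal total losses.
  Σ-neighbours : ∀ f → Σ[ V ] (λ x → Σ[ N G x ] (λ _ → f x)) ≡ Σ[ V ] (λ x → Σ[ N G x ] f)
  Σ-neighbours f = begin
    Σ[ V ] (λ x → Σ[ N G x ] (λ _ → f x))
      ≡⟨ Σ-cong V (λ x → Σ-filter (adj G x) _ V) ⟩
    Σ[ V ] (λ x → Σ[ V ] (λ y → if adj G x y then f x else 0))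
      ≡⟨ Σ-swap V V (λ x y → if adj G x y then f x else 0) ⟩
    Σ[ V ] (λ y → Σ[ V ] (λ x → if adj G x y then f x else 0))
      ≡⟨ Σ-cong V (λ y → Σ-cong V (λ x → cong (λ b → if b then f x else 0) (symm G x y))) ⟩
    Σ[ V ] (λ y → Σ[ V ] (λ x → if adj G y x then f x else 0))
      ≡⟨ Σ-cong V (λ y → Σ-filter (adj G y) f V) ⟨
    Σ[ V ] (λ y → Σ[ N G y ] f) ∎
    where open ≡-Reasoning

  private
    ordered : Fin n → Fin n → ℕ
    ordered x y = if (toℕ x <ᵇ toℕ y) ∧ adj G x y then 1 else 0

  -- `edgeCount` counts an edge at its smaller end; adjacent vertices differ, so exactly one order
  -- applies.
  edge-orientations : ∀ x y → (if adj G x y then 1 else 0) ≡ ordered x y + ordered y x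
  edge-orientations x y rewrite symm G y x
    with adj G x y in e | toℕ x <ᵇ toℕ y in p | toℕ y <ᵇ toℕ x in q
  ... | false | true  | true  = refl
  ... | false | true  | false = refl
  ... | false | false | true  = refl
  ... | false | false | false = refl
  ... | true  | true  | false = refl
  ... | true  | false | true  = refl
  ... | true  | true  | true  = contradiction (<ᵇ⇒ {y} {x} q) (ℕ.<⇒≯ (<ᵇ⇒ {x} {y} p))
    where
    <ᵇ⇒ : ∀ {x y : Fin n} → (toℕ x <ᵇ toℕ y) ≡ true → toℕ x < toℕ y
    <ᵇ⇒ {x} {y} eq = ℕ.<ᵇ⇒< (toℕ x) (toℕ y) (subst T (sym eq) _)
  ... | true  | false | false = contradiction
    (toℕ-injective (≤-antisym (≮ᵇ⇒ {y} {x} q) (≮ᵇ⇒ {x} {y} p))) (adj⇒≢ G e)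
    where
    ≮ᵇ⇒ : ∀ {x y : Fin n} → (toℕ x <ᵇ toℕ y) ≡ false → toℕ y ≤ toℕ x
    ≮ᵇ⇒ eq = ℕ.≮⇒≥ (λ lt → subst T eq (ℕ.<⇒<ᵇ lt))

  handshake : Σ[ V ] (λ x → length (N G x)) ≡ edgeCount G + edgeCount G
  handshake = begin
    Σ[ V ] (λ x → length (N G x))
      ≡⟨ Σ-cong V (λ x → trans (sym (ℕ.*-identityʳ _)) (sym (Σ-const (N G x) 1))) ⟩
    Σ[ V ] (λ x → Σ[ N G x ] (λ _ → 1))
      ≡⟨ Σ-cong V (λ x → Σ-filter (adj G x) _ V) ⟩
    Σ[ V ] (λ x → Σ[ V ] (λ y → if adj G x y then 1 else 0))
      ≡⟨ Σ-cong V (λ x → trans (Σ-cong V (edge-orientations x)) (Σ-+ V _ _)) ⟩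
    Σ[ V ] (λ x → Σ[ V ] (ordered x) + Σ[ V ] (λ y → ordered y x))
      ≡⟨ Σ-+ V _ _ ⟩
    edgeCount G + Σ[ V ] (λ x → Σ[ V ] (λ y → ordered y x))
      ≡⟨ cong (edgeCount G +_) (Σ-swap V V ordered) ⟨
    edgeCount G + edgeCount G ∎
    where open ≡-Reasoning

  -- Summing the local bounds gives `8 * n + S` on the left and six times the edge count plus `S` on
  -- the right, where `S` is the total charge moved; cancelling `S` and halving finishes.
  discharge : ∀ f → (∀ x → 8 + Σ[ N G x ] f ≤ length (N G x) * (3 + f x)) → 4 * n ≤ 3 * edgeCount G
  discharge f bound = ℕ.*-cancelˡ-≤ 2 (ℕ.+-cancelʳ-≤ S _ _ (begin
    2 * (4 * n) + S
      ≡⟨ cong (_+ S) (trans (eight n) (cong (_* 8) (sym (length-tabulate {n = n} (λ i → i))))) ⟩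
    length V * 8 + S
      ≡⟨ cong (_+ S) (Σ-const V 8) ⟨
    Σ[ V ] (λ _ → 8) + S
      ≡⟨ Σ-+ V _ _ ⟨
    Σ[ V ] (λ x → 8 + Σ[ N G x ] f)
      ≤⟨ Σ-mono V bound ⟩
    Σ[ V ] (λ x → length (N G x) * (3 + f x))
      ≡⟨ Σ-cong V (λ x → trans (ℕ.*-distribˡ-+ (length (N G x)) 3 (f x))
                           (cong (_ +_) (sym (Σ-const (N G x) (f x))))) ⟩
    Σ[ V ] (λ x → length (N G x) * 3 + Σ[ N G x ] (λ _ → f x))
      ≡⟨ Σ-+ V _ _ ⟩
    Σ[ V ] (λ x → length (N G x) * 3) + Σ[ V ] (λ x → Σ[ N G x ] (λ _ → f x))
      ≡⟨ cong₂ _+_ (trans (Σ-* V _ 3) (cong (_* 3) handshake)) (Σ-neighbours f) ⟩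
    (edgeCount G + edgeCount G) * 3 + S
      ≡⟨ cong (_+ S) (six (edgeCount G)) ⟩
    2 * (3 * edgeCount G) + S ∎))
    where
    open ℕ.≤-Reasoning
    S = Σ[ V ] (λ x → Σ[ N G x ] f)
    eight : ∀ n → 2 * (4 * n) ≡ n * 8
    eight = solve-∀
    six : ∀ e → (e + e) * 3 ≡ 2 * (3 * e)
    six = solve-∀

theorem1p8 : (r n : ℕ) → 6 ≤ r → r ≤ n → (G : Graph n) → (c : Coloring n) →
    IsEdgeColoring G c → IsRainbowColoring G c → RainbowSaturated r G c →
    4 * n ≤ 3 * edgeCount G
-- Writing `r` as `6 + k` lets early positions on a path be told apart from late ones by
-- computation.
theorem1p8 r n 6≤r r≤n G c col rb sat with k , refl ← ℕ.m≤n⇒∃[o]m+o≡n 6≤r =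
  discharge G (h G) (Saturated.vertex-bound G c r≤n col rb sat)
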